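{- Let $k$ be a positive integer. For every integer $n \ge 0$, let $m_n$ denote the number of $k$-coloured Motzkin paths of length $n$, and let $f_n^{(o)}$ denote the number of $k$-coloured Motzkin prefixes of length $n$ whose final point has odd height. Then, for all $n \ge 0$, \[ f_{n+1}^{(o)} = (n+1)\, m_n . \]
   Context: A $k$-coloured Motzkin prefix (left factor) of length $n$ is a lattice path starting at $(0,0)$, consisting of $n$ steps, each being a rise step $(1,1)$, a fall step $(1,-1)$, or a horizontal step $(1,0)$ carrying one of $k$ colours (rise and fall steps are uncoloured, so there are $k+2$ kinds of steps), and never going below the $x$-axis. Its final height is the ordinate of its last point. A $k$-coloured Motzkin path of length $n$ is a $k$-coloured Motzkin prefix of length $n$ with final height $0$. The empty path is the unique $k$-coloured Motzkin path of length $0$. -}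

module Defs where

open import Data.Nat.Base using (ℕ; zero; suc)
open import Data.Integer.Base using (ℤ; +_; 0ℤ; 1ℤ; -1ℤ; _+_; _≤_)
open import Data.Integer.Properties using (_≟_; _≤?_)
open import Data.Integer.Divisibility.Signed using (_∣_; _∣?_)
open import Data.Fin.Base using (Fin)
open import Data.List.Base as List using (List; length; filter; allFin; cartesianProductWith)
open import Data.List.Membership.Propositional using (_∈_)
open import Data.List.Membership.Propositional.Properties
  using (∈-map⁺; ∈-allFin; ∈-cartesianProductWith⁺)
open import Data.List.Relation.Unary.All.Properties using () renaming (map⁺ to All-map⁺)
import Data.List.Relation.Unary.All as ListAll
open import Data.List.Relation.Unary.Any using (here; there)
import Data.List.Relation.Unary.AllPairs as AllPairs
open import Data.List.Relation.Unary.Unique.Propositional using (Unique)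
open import Data.List.Relation.Unary.Unique.Propositional.Properties
  using (map⁺; allFin⁺; cartesianProductWith⁺)
open import Data.Product.Base using (_×_)
open import Data.Vec.Base using (Vec; []; _∷_; last)
open import Data.Vec.Properties using (∷-injective)
open import Data.Vec.Relation.Unary.All using (All; all?)
open import Relation.Binary.PropositionalEquality using (_≡_; refl)
open import Relation.Nullary.Decidable using (¬?; _×-dec_)
open import Relation.Nullary.Negation using (¬_)
open import Relation.Unary using (Decidable)

data Step (k : ℕ) : Set where
  rise fall  : Step k
  horizontal : (colour : Fin k) → Step k

Δ : ∀ {k} → Step k → ℤ
Δ rise           = 1ℤ
Δ fall           = -1ℤ
Δ (horizontal _) = 0ℤ

-- Every step advances the abscissa by 1, so a lattice path is determined by its
-- starting point and its word of steps, and its i-th point has abscissa i.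
Path : ℕ → ℕ → Set
Path k n = Vec (Step k) n

-- The ordinates of all n + 1 points of the path starting at ordinate y.
ordinates : ∀ {k n} → ℤ → Path k n → Vec ℤ (suc n)
ordinates y []      = y ∷ []
ordinates y (s ∷ p) = y ∷ ordinates (y + Δ s) p

finalHeight : ∀ {k n} → Path k n → ℤ
finalHeight p = last (ordinates 0ℤ p)

IsPrefix : ∀ {k n} → Path k n → Set
IsPrefix p = All (0ℤ ≤_) (ordinates 0ℤ p)

IsMotzkin : ∀ {k n} → Path k n → Set
IsMotzkin p = IsPrefix p × finalHeight p ≡ 0ℤ

Odd : ℤ → Set
Odd y = ¬ (+ 2 ∣ y)

IsOddPrefix : ∀ {k n} → Path k n → Set
IsOddPrefix p = IsPrefix p × Odd (finalHeight p)

isPrefix? : ∀ {k n} → Decidable (IsPrefix {k} {n})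
isPrefix? p = all? (0ℤ ≤?_) (ordinates 0ℤ p)

isMotzkin? : ∀ {k n} → Decidable (IsMotzkin {k} {n})
isMotzkin? p = isPrefix? p ×-dec (finalHeight p ≟ 0ℤ)

isOddPrefix? : ∀ {k n} → Decidable (IsOddPrefix {k} {n})
isOddPrefix? p = isPrefix? p ×-dec ¬? (+ 2 ∣? finalHeight p)

allSteps : ∀ k → List (Step k)
allSteps k = rise List.∷ fall List.∷ List.map horizontal (allFin k)

allPaths : ∀ k n → List (Path k n)
allPaths k zero    = [] List.∷ List.[]
allPaths k (suc n) = cartesianProductWith _∷_ (allSteps k) (allPaths k n)

count : ∀ {k n} {P : Path k n → Set} → Decidable P → ℕ
count {k} {n} P? = length (filter P? (allPaths k n))

motzkin : ℕ → ℕ → ℕ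
motzkin k n = count (isMotzkin? {k} {n})

oddPrefixes : ℕ → ℕ → ℕ
oddPrefixes k n = count (isOddPrefix? {k} {n})

-- allPaths lists every path exactly once, so count is a cardinality.

allSteps-complete : ∀ {k} (s : Step k) → s ∈ allSteps k
allSteps-complete rise           = here refl
allSteps-complete fall           = there (here refl)
allSteps-complete (horizontal c) = there (there (∈-map⁺ horizontal (∈-allFin c)))

allSteps-unique : ∀ k → Unique (allSteps k)
allSteps-unique k =
  ((λ ()) ListAll.∷ All-map⁺ (ListAll.universal (λ _ ()) (allFin k)))
  AllPairs.∷ All-map⁺ (ListAll.universal (λ _ ()) (allFin k))
  AllPairs.∷ map⁺ (λ { refl → refl }) (allFin⁺ k)

allPaths-complete : ∀ {k n} (p : Path k n) → p ∈ allPaths k n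
allPaths-complete []      = here refl
allPaths-complete (s ∷ p) =
  ∈-cartesianProductWith⁺ _∷_ (allSteps-complete s) (allPaths-complete p)

allPaths-unique : ∀ k n → Unique (allPaths k n)
allPaths-unique k zero    = ListAll.[] AllPairs.∷ AllPairs.[]
allPaths-unique k (suc n) =
  cartesianProductWith⁺ _∷_ ∷-injective (allSteps-unique k) (allPaths-unique k n)

{-# OPTIONS --safe #-}
-- Let t n j be the coefficient of xʲ in Pⁿ, where P = x + k + x⁻¹.  By the
-- reflection principle there are t n y − t n (y + 2) nonnegative paths from height
-- y to height 0, so m n = t n 0 − t n 2.  Summing the reflected counts over the odd
-- final heights telescopes: from height 0 exactly t n 1 nonnegative paths end at
-- odd height.  Comparing the coefficients of x in
-- x · (Pⁿ⁺¹)′ = (n + 1) (x − x⁻¹) Pⁿ yields t (n + 1) 1 = (n + 1) (t n 0 − t n 2).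
module Submission where

open import Defs
open import Data.Bool.Base using (true; false; _∧_; not)
open import Data.Fin.Base using (Fin)
open import Data.Integer.Base as ℤ using (ℤ; +_; 0ℤ; -1ℤ)
import Data.Integer.Properties as ℤ
open import Data.Integer.Divisibility.Signed using (_∣?_; ∣-refl; ∣m∣n⇒∣m+n; ∣m+n∣m⇒∣n)
open import Data.List.Base using (List; []; _∷_; _++_; length; filter; map; allFin; cartesianProductWith)
open import Data.List.Properties using (length-++; filter-++; length-tabulate)
open import Data.Nat.Base using (ℕ; zero; suc; _+_; _*_; NonZero)
open import Data.Nat.Properties using (+-comm; +-identityʳ; +-cancelʳ-≡; *-distribˡ-+)
open import Data.Nat.Tactic.RingSolver using (solve-∀)
open import Data.Product.Base using (_×_; _,_)
open import Data.Vec.Base as Vec using (Vec; initLast)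
open import Data.Vec.Relation.Unary.All using (All; all?)
open import Function.Bundles using (mk⇔)
open import Relation.Binary.PropositionalEquality
  using (_≡_; refl; trans; cong; cong₂; module ≡-Reasoning)
open import Relation.Nullary.Decidable using (does; does-⇔; ¬?; _×-dec_)
open import Relation.Unary using (Decidable)

open ≡-Reasoning

-- Lengths of filtered lists

last-∷ : ∀ {A : Set} {n} (x : A) (xs : Vec A (suc n)) → Vec.last (x Vec.∷ xs) ≡ Vec.last xs
last-∷ x xs with initLast xs
... | _ , _ , refl = refl

module _ {A B : Set} {P : B → Set} {Q : A → Set} (P? : Decidable P) (Q? : Decidable Q) where

  length-filter-map : (f : A → B) → (∀ x → does (P? (f x)) ≡ does (Q? x)) →
                      ∀ xs → length (filter P? (map f xs)) ≡ length (filter Q? xs)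
  length-filter-map f eq [] = refl
  length-filter-map f eq (x ∷ xs) rewrite eq x with does (Q? x)
  ... | true  = cong suc (length-filter-map f eq xs)
  ... | false = length-filter-map f eq xs

length-filter-++ : ∀ {A : Set} {P : A → Set} (P? : Decidable P) xs ys →
                   length (filter P? (xs ++ ys)) ≡ length (filter P? xs) + length (filter P? ys)
length-filter-++ P? xs ys = trans (cong length (filter-++ P? xs ys)) (length-++ (filter P? xs))

length-filter-none : ∀ {A : Set} {P : A → Set} (P? : Decidable P) →
                     (∀ x → does (P? x) ≡ false) → ∀ xs → length (filter P? xs) ≡ 0
length-filter-none P? eq [] = refl
length-filter-none P? eq (x ∷ xs) rewrite eq x = length-filter-none P? eq xs

-- First-step recurrence for nonnegative paths

module Counting {Q : ℤ → Set} (Q? : Decidable Q) (k : ℕ) where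

  -- An arbitrary starting height lets the first-step recursion close. At height 0 this unfolds to
  -- `IsMotzkin` or `IsOddPrefix`, according to the choice of `Q`.
  Admissible : ∀ {n} → ℤ → Path k n → Set
  Admissible y p = All (0ℤ ℤ.≤_) (ordinates y p) × Q (Vec.last (ordinates y p))

  admissible? : ∀ {n} y → Decidable (Admissible {n} y)
  admissible? y p = all? (0ℤ ℤ.≤?_) (ordinates y p) ×-dec Q? (Vec.last (ordinates y p))

  countFrom : ℕ → ℤ → ℕ
  countFrom n y = count {k} {n} (admissible? y)

  countFrom-negative : ∀ n → countFrom n -1ℤ ≡ 0
  countFrom-negative n = length-filter-none (admissible? -1ℤ) inadmissible (allPaths k n)
    where
    inadmissible : ∀ {n} (p : Path k n) → does (admissible? -1ℤ p) ≡ false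
    inadmissible Vec.[]      = refl
    inadmissible (s Vec.∷ p) = refl

  -- From `+ y` the test of the first ordinate computes to `true` and drops out, so only the final
  -- point needs rewriting.
  admissible-∷ : ∀ {n} y (s : Step k) (p : Path k n) →
                 does (admissible? (+ y) (s Vec.∷ p)) ≡ does (admissible? (+ y ℤ.+ Δ s) p)
  admissible-∷ y s p =
    cong (λ z → does (all? (0ℤ ℤ.≤?_) (ordinates (+ y ℤ.+ Δ s) p)) ∧ does (Q? z))
         (last-∷ (+ y) (ordinates (+ y ℤ.+ Δ s) p))

  count-∷ : ∀ n y (s : Step k) →
            length (filter (admissible? (+ y)) (map (s Vec.∷_) (allPaths k n)))
            ≡ countFrom n (+ y ℤ.+ Δ s)
  count-∷ n y s = length-filter-map (admissible? (+ y)) (admissible? (+ y ℤ.+ Δ s))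
                    (s Vec.∷_) (admissible-∷ y s) (allPaths k n)

  count-horizontal : ∀ n y (cs : List (Fin k)) →
    length (filter (admissible? (+ y)) (cartesianProductWith Vec._∷_ (map horizontal cs) (allPaths k n)))
    ≡ length cs * countFrom n (+ y)
  count-horizontal n y []       = refl
  count-horizontal n y (c ∷ cs) = trans
    (length-filter-++ (admissible? (+ y)) (map (horizontal c Vec.∷_) (allPaths k n)) _)
    (cong₂ _+_
      (trans (count-∷ n y (horizontal c)) (cong (countFrom n) (ℤ.+-identityʳ (+ y))))
      (count-horizontal n y cs))

  -- The fall term keeps its integer argument: it computes to `-1ℤ` when `y` is 0, where the count
  -- vanishes, and to the predecessor otherwise.
  countFrom-suc : ∀ n y → countFrom (suc n) (+ y) ≡
    countFrom n (+ suc y) + (countFrom n (+ y ℤ.+ -1ℤ) + k * countFrom n (+ y))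
  countFrom-suc n y = trans
    (length-filter-++ (admissible? (+ y)) (map (rise Vec.∷_) (allPaths k n)) _)
    (cong₂ _+_
      (trans (count-∷ n y rise) (cong (λ z → countFrom n (+ z)) (+-comm y 1)))
      (trans (length-filter-++ (admissible? (+ y)) (map (fall Vec.∷_) (allPaths k n)) _)
        (cong₂ _+_ (count-∷ n y fall)
          (trans (count-horizontal n y (allFin k))
            (cong (_* countFrom n (+ y)) (length-tabulate {n = k} _))))))

  countFrom-suc-zero : ∀ n → countFrom (suc n) (+ 0) ≡ countFrom n (+ 1) + k * countFrom n (+ 0)
  countFrom-suc-zero n = trans (countFrom-suc n 0)
    (cong (λ z → countFrom n (+ 1) + (z + k * countFrom n (+ 0))) (countFrom-negative n))

-- Trinomial coefficients

-- The coefficient of xʲ (equivalently of x⁻ʲ) in (x + k + x⁻¹)ⁿ.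
trinomial : ℕ → ℕ → ℕ → ℕ
trinomial k zero    zero    = 1
trinomial k zero    (suc j) = 0
trinomial k (suc n) zero    = k * trinomial k n 0 + 2 * trinomial k n 1
trinomial k (suc n) (suc j) =
  trinomial k n j + k * trinomial k n (suc j) + trinomial k n (suc (suc j))

-- Compares the coefficients of xʲ⁺¹ in x · (Pⁿ⁺¹)′ = (n + 1) (x − x⁻¹) Pⁿ.
trinomial-derivative : ∀ k n j →
  suc j * trinomial k (suc n) (suc j) + suc n * trinomial k n (suc (suc j)) ≡ suc n * trinomial k n j
trinomial-derivative k zero zero = base k
  where
  base : ∀ k → 1 * (1 + k * 0 + 0) + 1 * 0 ≡ 1
  base = solve-∀
trinomial-derivative k zero (suc j) = base k j
  where
  base : ∀ k j → suc (suc j) * (0 + k * 0 + 0) + 1 * 0 ≡ 0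
  base = solve-∀
trinomial-derivative k (suc n) zero = begin
  1 * (t′ 0 + k * t′ 1 + t′ 2) + suc (suc n) * t′ 2
    -- Of the `n + 3` copies of `t′ 2` two are kept and `suc n` are expanded by the recurrence,
    -- which produces the induction hypotheses at 0 and 1.
    ≡⟨ split k n (t′ 0) (t′ 1) (t 1) (t 2) (t 3) ⟩
  k * (1 * t′ 1 + suc n * t 2) + (2 * t′ 2 + suc n * t 3) + (suc n * t 1 + t′ 0)
    ≡⟨ cong₂ (λ a b → k * a + b + (suc n * t 1 + t′ 0))
         (trinomial-derivative k n 0) (trinomial-derivative k n 1) ⟩
  k * (suc n * t 0) + suc n * t 1 + (suc n * t 1 + t′ 0)
    ≡⟨ merge k n (t 0) (t 1) ⟩
  suc (suc n) * t′ 0 ∎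
  where
  t t′ : ℕ → ℕ
  t  = trinomial k n
  t′ = trinomial k (suc n)
  split : ∀ k n a b u v w → let c = u + k * v + w in
    1 * (a + k * b + c) + suc (suc n) * c ≡
    k * (1 * b + suc n * v) + (2 * c + suc n * w) + (suc n * u + a)
  split = solve-∀
  merge : ∀ k n u v → let a = k * u + 2 * v in
    k * (suc n * u) + suc n * v + (suc n * v + a) ≡ suc (suc n) * a
  merge = solve-∀
trinomial-derivative k (suc n) (suc j) = begin
  suc (suc j) * (t′ (1 + j) + k * t′ (2 + j) + t′ (3 + j)) + suc (suc n) * t′ (3 + j)
    -- Again `suc n` copies of `t′ (3 + j)` are expanded; the spare `t′ (1 + j)` later raises the
    -- factor `suc n` to `suc (suc n)`.
    ≡⟨ split k n j (t′ (1 + j)) (t′ (2 + j)) (t (2 + j)) (t (3 + j)) (t (4 + j)) ⟩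
  (suc j * t′ (1 + j) + suc n * t (2 + j)) + k * (suc (suc j) * t′ (2 + j) + suc n * t (3 + j))
    + (suc (suc (suc j)) * t′ (3 + j) + suc n * t (4 + j)) + t′ (1 + j)
    ≡⟨ cong (_+ t′ (1 + j))
         (cong₂ _+_
           (cong₂ (λ a b → a + k * b) (trinomial-derivative k n j) (trinomial-derivative k n (1 + j)))
           (trinomial-derivative k n (2 + j))) ⟩
  suc n * t j + k * (suc n * t (1 + j)) + suc n * t (2 + j) + t′ (1 + j)
    ≡⟨ merge k n (t j) (t (1 + j)) (t (2 + j)) ⟩
  suc (suc n) * t′ (1 + j) ∎
  where
  t t′ : ℕ → ℕ
  t  = trinomial k n
  t′ = trinomial k (suc n)
  split : ∀ k n j a b u v w → let c = u + k * v + w in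
    suc (suc j) * (a + k * b + c) + suc (suc n) * c ≡
    (suc j * a + suc n * u) + k * (suc (suc j) * b + suc n * v)
      + (suc (suc (suc j)) * c + suc n * w) + a
  split = solve-∀
  merge : ∀ k n u v w → let a = u + k * v + w in
    suc n * u + k * (suc n * v) + suc n * w + a ≡ suc (suc n) * a
  merge = solve-∀

-- Alternate sums of trinomial coefficients

-- The sum of the coefficients of xⁱ in (x + k + x⁻¹)ⁿ over i = y, y − 2, …, 2 − y.
-- By reflection it counts the nonnegative paths from height y − 1 to an odd height.
alternateSum : ℕ → ℕ → ℕ → ℕ
alternateSum k n zero          = 0
alternateSum k n (suc zero)    = trinomial k n 1
alternateSum k n (suc (suc y)) = alternateSum k n y + trinomial k n (suc (suc y)) + trinomial k n y

-- Multiplication by x + k + x⁻¹ shifts the window y + 1, y - 1, ..., 1 - y up and down by one; with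
-- multiplicity, the two shifts make up the windows of `y + 2` and `y`. The value 0 at index 0
-- matches the forbidden height -1.
alternateSum-suc : ∀ k n y → alternateSum k (suc n) (suc y) ≡
  alternateSum k n (suc (suc y)) + (alternateSum k n y + k * alternateSum k n (suc y))
alternateSum-suc k n zero = identity k (t 0) (t 1) (t 2)
  where
  t = trinomial k n
  identity : ∀ k u v w → u + k * v + w ≡ 0 + w + u + (0 + k * v)
  identity = solve-∀
alternateSum-suc k n (suc zero) = identity k (t 0) (t 1) (t 2) (t 3)
  where
  t = trinomial k n
  identity : ∀ k t₀ t₁ t₂ t₃ → 0 + (t₁ + k * t₂ + t₃) + (k * t₀ + 2 * t₁) ≡
    t₁ + t₃ + t₁ + (t₁ + k * (0 + t₂ + t₀))
  identity = solve-∀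
alternateSum-suc k n (suc (suc y)) = begin
  alternateSum k (suc n) (1 + y) + t′ (3 + y) + t′ (1 + y)
    ≡⟨ cong (λ z → z + t′ (3 + y) + t′ (1 + y)) (alternateSum-suc k n y) ⟩
  s (2 + y) + (s y + k * s (1 + y)) + t′ (3 + y) + t′ (1 + y)
    ≡⟨ identity k (s y) (s (1 + y)) (t y) (t (1 + y)) (t (2 + y)) (t (3 + y)) (t (4 + y)) ⟩
  s (4 + y) + (s (2 + y) + k * s (3 + y)) ∎
  where
  s t t′ : ℕ → ℕ
  s  = alternateSum k n
  t  = trinomial k n
  t′ = trinomial k (suc n)
  identity : ∀ k s₀ s₁ t₀ t₁ t₂ t₃ t₄ →
    s₀ + t₂ + t₀ + (s₀ + k * s₁) + (t₂ + k * t₃ + t₄) + (t₀ + k * t₁ + t₂) ≡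
    s₀ + t₂ + t₀ + t₄ + t₂ + (s₀ + t₂ + t₀ + k * (s₁ + t₃ + t₁))
  identity = solve-∀

-- Paths ending at height 0

module ToZero = Counting (ℤ._≟ 0ℤ)

-- The difference of the two coefficients obeys the first-step recurrence and, by the symmetry of
-- coefficients, vanishes at y = -1. The additive form avoids subtraction in `ℕ`.
countToZero-reflection : ∀ k n y →
  ToZero.countFrom k n (+ y) + trinomial k n (suc (suc y)) ≡ trinomial k n y
countToZero-reflection k zero zero    = refl
countToZero-reflection k zero (suc y) = refl
countToZero-reflection k (suc n) zero = begin
  ToZero.countFrom k (suc n) (+ 0) + t′ 2
    ≡⟨ cong (_+ t′ 2) (ToZero.countFrom-suc-zero k n) ⟩
  m 1 + k * m 0 + t′ 2
    ≡⟨ split k (m 0) (m 1) (t 1) (t 2) (t 3) ⟩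
  k * (m 0 + t 2) + (m 1 + t 3) + t 1
    ≡⟨ cong₂ (λ a b → k * a + b + t 1) (countToZero-reflection k n 0) (countToZero-reflection k n 1) ⟩
  k * t 0 + t 1 + t 1
    ≡⟨ merge k (t 0) (t 1) ⟩
  t′ 0 ∎
  where
  m t t′ : ℕ → ℕ
  m y = ToZero.countFrom k n (+ y)
  t   = trinomial k n
  t′  = trinomial k (suc n)
  split : ∀ k m₀ m₁ t₁ t₂ t₃ →
    m₁ + k * m₀ + (t₁ + k * t₂ + t₃) ≡ k * (m₀ + t₂) + (m₁ + t₃) + t₁
  split = solve-∀
  merge : ∀ k u v → k * u + v + v ≡ k * u + 2 * v
  merge = solve-∀
countToZero-reflection k (suc n) (suc y) = begin
  ToZero.countFrom k (suc n) (+ suc y) + t′ (3 + y)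
    ≡⟨ cong (_+ t′ (3 + y)) (ToZero.countFrom-suc k n (suc y)) ⟩
  m (2 + y) + (m y + k * m (1 + y)) + t′ (3 + y)
    ≡⟨ split k (m y) (m (1 + y)) (m (2 + y)) (t (2 + y)) (t (3 + y)) (t (4 + y)) ⟩
  m y + t (2 + y) + k * (m (1 + y) + t (3 + y)) + (m (2 + y) + t (4 + y))
    ≡⟨ cong₂ _+_
         (cong₂ (λ a b → a + k * b) (countToZero-reflection k n y) (countToZero-reflection k n (1 + y)))
         (countToZero-reflection k n (2 + y)) ⟩
  t′ (1 + y) ∎
  where
  m t t′ : ℕ → ℕ
  m y = ToZero.countFrom k n (+ y)
  t   = trinomial k n
  t′  = trinomial k (suc n)
  split : ∀ k m₀ m₁ m₂ t₂ t₃ t₄ →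
    m₂ + (m₀ + k * m₁) + (t₂ + k * t₃ + t₄) ≡ m₀ + t₂ + k * (m₁ + t₃) + (m₂ + t₄)
  split = solve-∀

-- Paths ending at odd height

odd? : Decidable Odd
odd? y = ¬? (+ 2 ∣? y)

module ToOdd = Counting odd?

odd?-+2 : ∀ y → does (odd? (+ suc (suc y))) ≡ does (odd? (+ y))
odd?-+2 y = cong not (does-⇔
  (mk⇔ (λ 2∣2+y → ∣m+n∣m⇒∣n {m = + 2} {n = + y} 2∣2+y ∣-refl) (∣m∣n⇒∣m+n {m = + 2} ∣-refl))
  (+ 2 ∣? + suc (suc y)) (+ 2 ∣? + y))

countToOdd-zero-+2 : ∀ k y → ToOdd.countFrom k 0 (+ suc (suc y)) ≡ ToOdd.countFrom k 0 (+ y)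
countToOdd-zero-+2 k y =
  length-filter-map (ToOdd.admissible? k (+ suc (suc y))) (ToOdd.admissible? k (+ y))
    (λ p → p) (λ { Vec.[] → odd?-+2 y }) (Vec.[] ∷ [])

-- Both sides obey the same recurrence in `n`. For `n = 0` the window y + 1, y - 1, ..., 1 - y
-- contains 0, the only index with a nonzero coefficient, exactly when `y` is odd.
countToOdd : ∀ k n y → ToOdd.countFrom k n (+ y) ≡ alternateSum k n (suc y)
countToOdd k zero zero          = refl
countToOdd k zero (suc zero)    = refl
countToOdd k zero (suc (suc y)) = begin
  ToOdd.countFrom k 0 (+ suc (suc y))   ≡⟨ countToOdd-zero-+2 k y ⟩
  ToOdd.countFrom k 0 (+ y)             ≡⟨ countToOdd k zero y ⟩
  -- The two coefficients added to the window have positive index, so they vanish in P⁰ = 1.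
  alternateSum k 0 (suc y)              ≡⟨ +-identityʳ _ ⟨
  alternateSum k 0 (suc y) + 0          ≡⟨ +-identityʳ _ ⟨
  alternateSum k 0 (suc y) + 0 + 0      ∎
countToOdd k (suc n) zero = begin
  ToOdd.countFrom k (suc n) (+ 0)
    ≡⟨ ToOdd.countFrom-suc-zero k n ⟩
  ToOdd.countFrom k n (+ 1) + k * ToOdd.countFrom k n (+ 0)
    ≡⟨ cong₂ (λ a b → a + k * b) (countToOdd k n 1) (countToOdd k n 0) ⟩
  alternateSum k n 2 + k * alternateSum k n 1
    ≡⟨ alternateSum-suc k n 0 ⟨
  alternateSum k (suc n) 1 ∎
countToOdd k (suc n) (suc y) = begin
  ToOdd.countFrom k (suc n) (+ suc y)
    ≡⟨ ToOdd.countFrom-suc k n (suc y) ⟩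
  ToOdd.countFrom k n (+ suc (suc y)) + (ToOdd.countFrom k n (+ y) + k * ToOdd.countFrom k n (+ suc y))
    ≡⟨ cong₂ _+_ (countToOdd k n (suc (suc y)))
         (cong₂ (λ a b → a + k * b) (countToOdd k n y) (countToOdd k n (suc y))) ⟩
  alternateSum k n (3 + y) + (alternateSum k n (1 + y) + k * alternateSum k n (2 + y))
    ≡⟨ alternateSum-suc k n (suc y) ⟨
  alternateSum k (suc n) (suc (suc y)) ∎

theorem1 : ∀ (k : ℕ) .{{_ : NonZero k}} (n : ℕ) → oddPrefixes k (suc n) ≡ suc n * motzkin k n
-- Adding `suc n * t 2` to both sides turns the claim into the derivative identity at `j = 0`
-- combined with reflection from height 0.
theorem1 k n = trans (countToOdd k (suc n) 0) (+-cancelʳ-≡ (suc n * t 2) (trinomial k (suc n) 1) _ (begin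
  trinomial k (suc n) 1 + suc n * t 2      ≡⟨ cong (_+ suc n * t 2) (+-identityʳ (trinomial k (suc n) 1)) ⟨
  1 * trinomial k (suc n) 1 + suc n * t 2  ≡⟨ trinomial-derivative k n 0 ⟩
  suc n * t 0                              ≡⟨ cong (suc n *_) (countToZero-reflection k n 0) ⟨
  suc n * (motzkin k n + t 2)              ≡⟨ *-distribˡ-+ (suc n) (motzkin k n) (t 2) ⟩
  suc n * motzkin k n + suc n * t 2        ∎))
  where
  t : ℕ → ℕ
  t = trinomial k n
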